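{- Let $G$ and $H$ be F-cores. If $(G,H)$ is an F-gap, then $G$ is isomorphic to a graph obtained from $H$ by removing one vertex. Consequently, for F-cores $G$ and $H$, $(G,H)$ is a gap in the full homomorphism order if and only if $(G,H)$ is a gap in the embedding order.
   Context: Graphs are finite directed graphs with loops allowed. A full homomorphism $f:G\to H$ is a map $f:V_G\to V_H$ such that $(u,v)\in E_G\iff (f(u),f(v))\in E_H$ for all $u,v\in V_G$; an embedding is an injective full homomorphism. $G\leq^F H$ (resp. $G\leq^E H$) means that there is a full homomorphism (resp. an embedding) from $G$ to $H$. The full homomorphism order is the order induced by $\leq^F$ on finite directed graphs up to the equivalence $G\leq^F H\leq^F G$; the embedding order is the order induced by $\leq^E$ on isomorphism classes of finite directed graphs. An F-core is a graph with the minimum number of vertices in its equivalence class for $\leq^F$. A gap in an order is a pair $(x,y)$ with $x<y$ such that no $z$ satisfies $x<z<y$; an F-gap is a gap in the full homomorphism order. Removing a vertex means passing to the subgraph induced by the remaining vertices. -}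

module Defs where

open import Level using (Level; 0ℓ; _⊔_)
open import Data.Bool.Base using (Bool; T)
open import Data.Fin.Base using (Fin; punchIn)
open import Data.Nat.Base as ℕ using (ℕ; zero; suc)
open import Data.Product.Base using (∃; ∃-syntax; Σ-syntax; _×_)
open import Function.Bundles using (_⇔_; _↔_; Inverse)
open import Function.Definitions using (Injective)
open import Relation.Binary.Construct.NonStrictToStrict as Strict using ()
open import Relation.Binary.Core using (Rel)
open import Relation.Binary.PropositionalEquality.Core using (_≡_)
open import Relation.Nullary.Negation.Core using (¬_)

-- The edge set is an arbitrary subset of V × V, given by its
-- characteristic function; loops and the empty graph are allowed.
record Digraph : Set where
  constructor digraph
  field
    order : ℕ
    edge  : Fin order → Fin order → Bool

  Vertex : Set
  Vertex = Fin order

  Edge : Rel Vertex 0ℓ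
  Edge u v = T (edge u v)

open Digraph public

IsFullHom : (G H : Digraph) → (Vertex G → Vertex H) → Set
IsFullHom G H f = ∀ u v → Edge G u v ⇔ Edge H (f u) (f v)

IsEmbedding : (G H : Digraph) → (Vertex G → Vertex H) → Set
IsEmbedding G H f = Injective _≡_ _≡_ f × IsFullHom G H f

infix 4 _≤F_ _≤E_ _≃F_ _≅_

_≤F_ : Rel Digraph 0ℓ
G ≤F H = ∃ (IsFullHom G H)

_≤E_ : Rel Digraph 0ℓ
G ≤E H = ∃ (IsEmbedding G H)

_≃F_ : Rel Digraph 0ℓ
G ≃F H = G ≤F H × H ≤F G

_≅_ : Rel Digraph 0ℓ
G ≅ H = Σ[ φ ∈ (Vertex G ↔ Vertex H) ] IsFullHom G H (Inverse.to φ)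

IsFCore : Digraph → Set
IsFCore G = ∀ K → G ≃F K → order G ℕ.≤ order K

-- Gaps in the order induced by _≤_ on the classes of _≈_, expressed on
-- representatives: x < y means x ≤ y and not x ≈ y.
IsGap : ∀ {a ℓ₁ ℓ₂ : Level} {A : Set a} → Rel A ℓ₁ → Rel A ℓ₂ → Rel A (a ⊔ ℓ₁ ⊔ ℓ₂)
IsGap _≈_ _≤_ x y = x < y × ¬ (∃[ z ] (x < z × z < y))
  where open Strict _≈_ _≤_ using (_<_)

IsFGap : Rel Digraph 0ℓ
IsFGap = IsGap _≃F_ _≤F_

IsEGap : Rel Digraph 0ℓ
IsEGap = IsGap _≅_ _≤E_

-- The subgraph induced by the vertices other than v: punchIn v enumerates them.
removeVertex : (H : Digraph) → Vertex H → Digraph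
removeVertex (digraph zero    e) ()
removeVertex (digraph (suc n) e) v = digraph n λ i j → e (punchIn v i) (punchIn v j)

{-# OPTIONS --safe #-}

-- An F-core is a digraph without twins (distinct vertices with equal
-- neighbourhoods), and every full homomorphism out of it is injective.  Let
-- (G , H) be an F-gap of F-cores and S the set of vertices v with G ≤F H ∖ v;
-- for v in S the gap forces H ∖ v ≃F G.  If H had two more vertices than G,
-- then H ∖ v would have twins u, u' for every v in S; in H these are told apart
-- by v only, and they lie in S again, since either can replace the other in a
-- copy of G.  By Bondy's argument the |S| distinct rows of the adjacency matrix
-- indexed by S are already told apart by fewer than |S| columns, although every
-- column in S is indispensable: a contradiction.
module Submission where

open import Defs
open import Data.Bool.Base using (Bool; T)
open import Data.Bool.Properties as Bool using (⇔→≡; T-≡)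
open import Data.Empty using (⊥)
open import Data.Fin.Base as Fin using (Fin; punchIn; punchOut)
open import Data.Fin.Properties
  using (_≟_; any?; all?; ¬∀⟶∃¬; pigeonhole; injective⇒≤; <⇒notInjective; <⇒≢;
         punchIn-injective; punchIn-punchOut; punchOut-injective;
         sequence)
open import Data.List.Base using (List; []; _∷_; length; lookup; filter; allFin)
open import Data.List.Membership.DecPropositional using (_∈?_)
open import Data.List.Membership.Propositional using (_∈_; find; lose)
open import Data.List.Membership.Propositional.Properties
  using (∈-lookup; ∈-filter⁺; ∈-filter⁻; ∈-allFin)
open import Data.List.Relation.Unary.All as All using (All; []; _∷_)
open import Data.List.Relation.Unary.AllPairs using ([]; _∷_)
open import Data.List.Relation.Unary.Any as Any using (here; there; index)
open import Data.List.Relation.Unary.Any.Properties using (lookup-index)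
open import Data.List.Relation.Unary.Unique.Propositional using (Unique)
open import Data.List.Relation.Unary.Unique.Propositional.Properties
  using (filter⁺; allFin⁺)
open import Data.Nat.Base as ℕ using (ℕ; zero; suc; z≤n; s≤s)
open import Data.Nat.Properties as ℕ using ()
open import Data.Product.Base using (∃-syntax; _×_; _,_; proj₁; proj₂)
open import Data.Product.Properties using (≡-dec)
open import Effect.Monad using (RawMonad)
open import Function.Base using (_∘_; id)
open import Function.Bundles using (_⇔_; mk⇔; mk⤖; Inverse)
open import Function.Definitions using (Injective; StrictlySurjective)
open import Function.Consequences.Propositional
  using (strictlySurjective⇒surjective)
open import Function.Properties.Bijection using (⤖⇒↔)
import Function.Properties.Equivalence as ⇔
open import Relation.Binary.Definitions using (DecidableEquality)
open import Relation.Binary.PropositionalEquality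
  using (_≡_; _≢_; refl; sym; trans; cong; cong₂; subst; subst₂)
open import Relation.Nullary.Decidable
  using (Dec; yes; no; ¬?; _×-dec_; decidable-stable; ¬¬-excluded-middle)
open import Relation.Nullary.Negation
  using (¬_; contradiction; ¬¬-Monad)

private
  variable
    m n : ℕ
    G H K : Digraph

-- Injections between finite sets and counting in lists

injective⇒surjective : {f : Fin n → Fin n} →
  Injective _≡_ _≡_ f → StrictlySurjective _≡_ f
injective⇒surjective {suc n} {f} f-inj y with any? (λ x → f x ≟ y)
... | yes hit = hit
-- Deleting the missed value `y` from the codomain would squeeze `suc n` points injectively into
-- `n`.
... | no miss = contradiction (injective⇒≤ g-inj) ℕ.1+n≰n
  where
  y≢f : ∀ x → y ≢ f x
  y≢f x y≡fx = miss (x , sym y≡fx)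

  g-inj : Injective _≡_ _≡_ (λ x → punchOut (y≢f x))
  g-inj {i} {j} = f-inj ∘ punchOut-injective (y≢f i) (y≢f j)

missed-value : m ℕ.< n → (f : Fin m → Fin n) → ∃[ y ] (∀ x → y ≢ f x)
missed-value {m} {n} m<n f with
  ¬∀⟶∃¬ n (λ y → ∃[ x ] y ≡ f x) (λ y → any? (λ x → y ≟ f x))
    -- If `f` were onto, a choice of preimages would inject the larger set into the smaller.
    (λ onto → <⇒notInjective m<n λ {y} {y'} eq →
      trans (proj₂ (onto y)) (trans (cong f eq) (sym (proj₂ (onto y')))))
... | y , missed = y , λ x eq → missed (x , eq)

lookup-injective : ∀ {A : Set} {xs : List A} → Unique xs →
  Injective _≡_ _≡_ (lookup xs)
lookup-injective (x∉xs ∷ u) {Fin.zero}  {Fin.zero}  eq = refl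
lookup-injective (x∉xs ∷ u) {Fin.zero}  {Fin.suc j} eq =
  contradiction eq (All.lookup x∉xs (∈-lookup j))
lookup-injective (x∉xs ∷ u) {Fin.suc i} {Fin.zero}  eq =
  contradiction (sym eq) (All.lookup x∉xs (∈-lookup i))
lookup-injective (x∉xs ∷ u) {Fin.suc i} {Fin.suc j} eq =
  cong Fin.suc (lookup-injective u eq)

-- Sending each position in `xs` to a position of the same element in `ys` is injective.
unique-⊆⇒length≤ : ∀ {A : Set} {xs ys : List A} → Unique xs →
  (∀ {x} → x ∈ xs → x ∈ ys) → length xs ℕ.≤ length ys
unique-⊆⇒length≤ {xs = xs} {ys} u xs⊆ys =
  injective⇒≤ {f = λ i → index (xs⊆ys (∈-lookup i))} λ {i} {j} eq →
    lookup-injective u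
      (trans (lookup-index (xs⊆ys (∈-lookup i)))
        (trans (cong (lookup ys) eq) (sym (lookup-index (xs⊆ys (∈-lookup j))))))

-- Bondy's theorem on separating columns

module Bondy {A C B : Set} (_≟A_ : DecidableEquality A) (_≟B_ : DecidableEquality B)
  (row : A → C → B) (separate : ∀ u v → u ≢ v → ∃[ c ] row u c ≢ row v c) where

  AgreeOn : List C → A → A → Set
  AgreeOn cs u v = All (λ c → row u c ≡ row v c) cs

  Separating : List C → List A → Set
  Separating cs us = ∀ {u v} → u ∈ us → v ∈ us → AgreeOn cs u v → u ≡ v

  private
    flip-agree : ∀ {cs u v} → AgreeOn cs u v → AgreeOn cs v u
    flip-agree = All.map sym

    _then_ : ∀ {cs u v w} → AgreeOn cs u v → AgreeOn cs v w → AgreeOn cs u w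
    p then q = All.zipWith (λ (x , y) → trans x y) (p , q)

  -- Since cs separates us, a new row u agrees on cs with at most one row of us,
  -- so a single further column suffices.
  bondy : ∀ u us → ∃[ cs ] length cs ℕ.≤ length us × Separating cs (u ∷ us)
  bondy u [] = [] , z≤n , λ { (here refl) (here refl) _ → refl }
  bondy u (v ∷ us) with bondy v us
  ... | cs , cs≤us , sep with
        Any.any? (λ x → ¬? (u ≟A x) ×-dec All.all? (λ c → row u c ≟B row x c) cs) (v ∷ us)
  ...   | no none = cs , ℕ.m≤n⇒m≤1+n cs≤us , λ
            { (here refl) (here refl) _ → refl
            ; (here refl) (there y∈)  a → new y∈ a
            ; (there x∈)  (here refl) a → sym (new x∈ (flip-agree a))
            ; (there x∈)  (there y∈)  a → sep x∈ y∈ a }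
          where
          new : ∀ {y} → y ∈ v ∷ us → AgreeOn cs u y → u ≡ y
          new {y} y∈ a = decidable-stable (u ≟A y) λ u≢y → none (lose y∈ (u≢y , a))
  ...   | yes some with find some
  ...     | w , w∈ , u≢w , u~w with separate u w u≢w
  ...       | c , uc≢wc = c ∷ cs , s≤s cs≤us , λ
              { (here refl) (here refl) _       → refl
              ; (here refl) (there y∈)  a       → new y∈ a
              ; (there x∈)  (here refl) a       → sym (new x∈ (flip-agree a))
              ; (there x∈)  (there y∈)  (_ ∷ a) → sep x∈ y∈ a }
            where
            new : ∀ {y} → y ∈ v ∷ us → AgreeOn (c ∷ cs) u y → u ≡ y
            new y∈ (uc≡yc ∷ a) with sep w∈ y∈ (flip-agree u~w then a)
            ... | refl = contradiction uc≡yc uc≢wc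

-- Full homomorphisms, embeddings and isomorphisms

fullHom⇒edge-≡ : ∀ G H {f} → IsFullHom G H f →
  ∀ u v → edge G u v ≡ edge H (f u) (f v)
fullHom⇒edge-≡ G H hom u v =
  ⇔→≡ (⇔.trans (⇔.sym T-≡) (⇔.trans (hom u v) T-≡))

edge-≡⇒fullHom : ∀ G H {f} →
  (∀ u v → edge G u v ≡ edge H (f u) (f v)) → IsFullHom G H f
edge-≡⇒fullHom G H eq u v = mk⇔ (subst T (eq u v)) (subst T (sym (eq u v)))

≤F-trans : G ≤F H → H ≤F K → G ≤F K
≤F-trans (f , f-hom) (g , g-hom) =
  g ∘ f , λ u v → ⇔.trans (f-hom u v) (g-hom (f u) (f v))

≃F-sym : G ≃F H → H ≃F G
≃F-sym (G≤H , H≤G) = H≤G , G≤H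

≃F-trans : G ≃F H → H ≃F K → G ≃F K
≃F-trans {G} {H} {K} (G≤H , H≤G) (H≤K , K≤H) =
  ≤F-trans {G} {H} {K} G≤H H≤K , ≤F-trans {K} {H} {G} K≤H H≤G

≤E⇒≤F : G ≤E H → G ≤F H
≤E⇒≤F (f , _ , f-hom) = f , f-hom

≅⇒≃F : ∀ G H → G ≅ H → G ≃F H
≅⇒≃F G H (φ , hom) = (to , hom) , from , λ u v →
  subst₂ (λ x y → Edge H x y ⇔ Edge G (from u) (from v))
    (strictlyInverseˡ u) (strictlyInverseˡ v) (⇔.sym (hom (from u) (from v)))
  where open Inverse φ

≤E⇒order≤ : ∀ G H → G ≤E H → order G ℕ.≤ order H
≤E⇒order≤ G H (f , f-inj , _) = injective⇒≤ f-inj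

≤E∧order≥⇒≅ : ∀ G H → G ≤E H → order H ℕ.≤ order G → G ≅ H
≤E∧order≥⇒≅ G@(digraph m d) H@(digraph n e) G≤H n≤m
  with ℕ.≤-antisym (≤E⇒order≤ G H G≤H) n≤m
... | refl with G≤H
...   | f , f-inj , f-hom =
  ⤖⇒↔ (mk⤖ (f-inj , strictlySurjective⇒surjective (injective⇒surjective f-inj)))
  , f-hom

-- Twins

adjacency : (H : Digraph) → Vertex H → Vertex H → Bool × Bool
adjacency H u w = edge H u w , edge H w u

_≟₂_ : DecidableEquality (Bool × Bool)
_≟₂_ = ≡-dec Bool._≟_ Bool._≟_

Twins : (H : Digraph) → Vertex H → Vertex H → Set
Twins H u v = ∀ w → adjacency H u w ≡ adjacency H v w

TwinFree : Digraph → Set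
TwinFree H = ∀ u v → Twins H u v → u ≡ v

HasTwins : Digraph → Set
HasTwins H = ∃[ u ] ∃[ v ] (u ≢ v × Twins H u v)

twins? : ∀ H u v → Dec (Twins H u v)
twins? H u v = all? λ w → adjacency H u w ≟₂ adjacency H v w

hasTwins? : ∀ H → Dec (HasTwins H)
hasTwins? H = any? λ u → any? λ v → ¬? (u ≟ v) ×-dec twins? H u v

¬hasTwins⇒twinFree : ∀ H → ¬ HasTwins H → TwinFree H
¬hasTwins⇒twinFree H none u v t =
  decidable-stable (u ≟ v) λ u≢v → none (u , v , u≢v , t)

-- A full homomorphism reflects edges as well, so the image of a vertex determines its whole row of
-- adjacencies.
fullHom-fibre⇒twins : ∀ G H {f} → IsFullHom G H f →
  ∀ {u v} → f u ≡ f v → Twins G u v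
fullHom-fibre⇒twins G H {f} hom {u} {v} fu≡fv w = cong₂ _,_
  (trans (eq u w) (trans (cong (λ x → edge H x (f w)) fu≡fv) (sym (eq v w))))
  (trans (eq w u) (trans (cong (edge H (f w)) fu≡fv) (sym (eq w v))))
  where eq = fullHom⇒edge-≡ G H hom

twinFree⇒≤E : ∀ G H → TwinFree G → G ≤F H → G ≤E H
twinFree⇒≤E G H tf (f , hom) =
  f , (λ {u} {v} eq → tf u v (fullHom-fibre⇒twins G H hom eq)) , hom

smaller-image⇒hasTwins : ∀ G H → G ≤F H → order H ℕ.< order G → HasTwins G
smaller-image⇒hasTwins G H (f , hom) H<G with pigeonhole H<G f
... | u , v , u<v , fu≡fv = u , v , <⇒≢ u<v , fullHom-fibre⇒twins G H hom fu≡fv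

-- Redirecting a vertex to its twin and removing it

redirect : Fin n → Fin n → Fin n → Fin n
redirect u v w with w ≟ u
... | yes _ = v
... | no  _ = w

redirect-avoids : {u v : Fin n} → u ≢ v → ∀ w → u ≢ redirect u v w
redirect-avoids {u = u} u≢v w with w ≟ u
... | yes _   = u≢v
... | no  w≢u = w≢u ∘ sym

redirect-fullHom : ∀ H {u v} → Twins H u v → IsFullHom H H (redirect u v)
redirect-fullHom H {u} {v} t = edge-≡⇒fullHom H H λ w x →
  -- The ends of the edge are redirected one at a time: first the source, by the outgoing component,
  -- then the target, by the incoming one.
  trans (cong proj₁ (same w x)) (cong proj₂ (same x (redirect u v w)))
  where
  same : ∀ w x → adjacency H w x ≡ adjacency H (redirect u v w) x
  same w x with w ≟ u
  ... | yes refl = t x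
  ... | no  _    = refl

module _ {n : ℕ} (e : Fin (suc n) → Fin (suc n) → Bool) where

  private
    M : Digraph
    M = digraph (suc n) e

  removeVertex-≤F : ∀ v → removeVertex M v ≤F M
  removeVertex-≤F v = punchIn v , λ _ _ → ⇔.refl

  avoiding⇒≤F-removeVertex : ∀ G v {f} → IsFullHom G M f → (∀ w → v ≢ f w) →
    G ≤F removeVertex M v
  avoiding⇒≤F-removeVertex G v hom v≢f =
    (λ w → punchOut (v≢f w)) ,
    edge-≡⇒fullHom G (removeVertex M v) λ w x →
      trans (fullHom⇒edge-≡ G M hom w x)
        (sym (cong₂ e (punchIn-punchOut (v≢f w)) (punchIn-punchOut (v≢f x))))

  twins⇒≃F-removeVertex : ∀ {u v} → u ≢ v → Twins M u v → M ≃F removeVertex M u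
  twins⇒≃F-removeVertex {u} u≢v t =
    avoiding⇒≤F-removeVertex M u (redirect-fullHom M t) (redirect-avoids u≢v) ,
    removeVertex-≤F u

  fCore⇒¬≤F-removeVertex : IsFCore M → ∀ v → ¬ (M ≤F removeVertex M v)
  fCore⇒¬≤F-removeVertex core v M≤M∖v =
    ℕ.1+n≰n (core (removeVertex M v) (M≤M∖v , removeVertex-≤F v))

-- Removing one of two twins would give a smaller graph in the same class.
fCore⇒twinFree : ∀ H → IsFCore H → TwinFree H
fCore⇒twinFree (digraph (suc n) e) core = ¬hasTwins⇒twinFree _
  λ (u , v , u≢v , t) →
    fCore⇒¬≤F-removeVertex e core u (proj₁ (twins⇒≃F-removeVertex e u≢v t))

-- Twins are removed one at a time. Order and edges are separate arguments so that the recursion is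
-- structural in `n`.
twinFree-representative : ∀ n (e : Fin n → Fin n → Bool) →
  ∃[ C ] (TwinFree C × digraph n e ≃F C)
twinFree-representative zero e =
  digraph zero e , (λ ()) , (id , λ ()) , (id , λ ())
twinFree-representative (suc n) e with hasTwins? (digraph (suc n) e)
... | no none = M , ¬hasTwins⇒twinFree M none , M≃M , M≃M
  where
  M = digraph (suc n) e
  M≃M : M ≤F M
  M≃M = id , λ _ _ → ⇔.refl
... | yes (u , v , u≢v , t) with twinFree-representative n (edge (removeVertex (digraph (suc n) e) u))
...   | C , tf , M∖u≃C =
  C , tf , ≃F-trans {M} {removeVertex M u} {C} (twins⇒≃F-removeVertex e u≢v t) M∖u≃C
  where M = digraph (suc n) e

-- No F-gap between orders differing by two or more

module _ {n : ℕ} (e : Fin (suc n) → Fin (suc n) → Bool)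
  (G : Digraph) (core : IsFCore (digraph (suc n) e))
  (gap : IsFGap G (digraph (suc n) e)) (G<n : order G ℕ.< n) where

  private
    M : Digraph
    M = digraph (suc n) e

    S : Vertex M → Set
    S v = G ≤F removeVertex M v

    -- Without twins, `removeVertex M v` could not map to `G`, which has fewer than its `n`
    -- vertices, and so would lie strictly inside the gap.
    removal-hasTwins : ∀ {v} → S v → HasTwins (removeVertex M v)
    removal-hasTwins {v} G≤M∖v = decidable-stable (hasTwins? (removeVertex M v)) λ none →
      proj₂ gap
        ( removeVertex M v
        , (G≤M∖v , λ (_ , M∖v≤G) → none (smaller-image⇒hasTwins (removeVertex M v) G M∖v≤G G<n))
        , (removeVertex-≤F e v , λ (_ , M≤M∖v) → fCore⇒¬≤F-removeVertex e core v M≤M∖v))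

    -- Rerouting a map of `G` into `removeVertex M v` from `i` to its twin `j` makes it miss `i`.
    S-closed : ∀ {v i j} → S v → i ≢ j → Twins (removeVertex M v) i j → S (punchIn v i)
    S-closed {v} {i} {j} (f , f-hom) i≢j t =
      avoiding⇒≤F-removeVertex e G (punchIn v i) {punchIn v ∘ redirect i j ∘ f}
        (λ u w → ⇔.trans (f-hom u w) (redirect-fullHom (removeVertex M v) t (f u) (f w)))
        (λ w eq → redirect-avoids i≢j (f w) (punchIn-injective v _ _ eq))

    twins-agree : ∀ {v i j} → Twins (removeVertex M v) i j →
      ∀ {w} → v ≢ w → adjacency M (punchIn v i) w ≡ adjacency M (punchIn v j) w
    twins-agree {v} {i} {j} t {w} v≢w =
      subst (λ x → adjacency M (punchIn v i) x ≡ adjacency M (punchIn v j) x)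
        (punchIn-punchOut v≢w) (t (punchOut v≢w))

    separate : ∀ u v → u ≢ v → ∃[ w ] adjacency M u w ≢ adjacency M v w
    separate u v u≢v =
      ¬∀⟶∃¬ (suc n) _ (λ w → adjacency M u w ≟₂ adjacency M v w)
        (u≢v ∘ fCore⇒twinFree M core u v)

    open Bondy _≟_ _≟₂_ (adjacency M) separate

    -- Bondy's columns `cs` are fewer than the rows `u ∷ us`, yet every one of these vertices must
    -- occur among the columns.
    no-closed-list : ∀ us → Unique us → (∀ {v} → S v → v ∈ us) →
      (∀ {v} → v ∈ us → S v) → ∀ {v} → ¬ S v
    no-closed-list [] _ S⇒∈ _ Sv with S⇒∈ Sv
    ... | ()
    no-closed-list (u ∷ us) uniq S⇒∈ ∈⇒S _ with bondy u us
    ... | cs , cs≤us , sep =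
      ℕ.1+n≰n (ℕ.≤-trans (unique-⊆⇒length≤ uniq indispensable) cs≤us)
      where
      indispensable : ∀ {v} → v ∈ u ∷ us → v ∈ cs
      indispensable {v} v∈ with removal-hasTwins (∈⇒S v∈)
      -- Only column `v` tells the twins apart in `M`. Without it they would agree on `cs`, although
      -- both lie in `S` and hence among the separated rows.
      ... | i , j , i≢j , t = decidable-stable (_∈?_ _≟_ v cs) λ v∉cs →
        i≢j (punchIn-injective v i j
          (sep (S⇒∈ (S-closed (∈⇒S v∈) i≢j t))
               (S⇒∈ (S-closed (∈⇒S v∈) (i≢j ∘ sym) (sym ∘ t)))
               (All.tabulate λ c∈cs → twins-agree t λ { refl → v∉cs c∈cs })))

  fGap-not-wide : ⊥
  -- As the goal is `⊥`, excluded middle for `S` may be assumed at each of the finitely many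
  -- vertices; this allows `S` to be listed by `filter`.
  fGap-not-wide = sequence (RawMonad.rawApplicative ¬¬-Monad) (λ v → ¬¬-excluded-middle {A = S v})
    λ S? → no-closed-list (filter S? (allFin (suc n))) (filter⁺ S? (allFin⁺ (suc n)))
      (∈-filter⁺ S? (∈-allFin _)) (proj₂ ∘ ∈-filter⁻ S? {xs = allFin (suc n)})
      S-nonempty
    where
    f,hom = proj₁ (proj₁ gap)
    missed = missed-value (ℕ.m<n⇒m<1+n G<n) (proj₁ f,hom)

    S-nonempty : S (proj₁ missed)
    S-nonempty = avoiding⇒≤F-removeVertex e G (proj₁ missed) (proj₂ f,hom) (proj₂ missed)

fGap⇒order≤ : ∀ G H → IsFCore H → IsFGap G H → order H ℕ.≤ suc (order G)
fGap⇒order≤ G (digraph zero e)    core gap = z≤n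
fGap⇒order≤ G (digraph (suc n) e) core gap = s≤s (ℕ.≮⇒≥ (fGap-not-wide e G core gap))

-- Vertex removal and the equivalence of the two kinds of gap

twinFree∧order≥⇒≃F : ∀ G H → TwinFree G → G ≤F H → order H ℕ.≤ order G → G ≃F H
twinFree∧order≥⇒≃F G H tf G≤H H≤G =
  ≅⇒≃F G H (≤E∧order≥⇒≅ G H (twinFree⇒≤E G H tf G≤H) H≤G)

fGap⇒vertex-removal : ∀ G H → IsFCore G → IsFCore H → IsFGap G H →
  ∃[ v ] (G ≅ removeVertex H v)
fGap⇒vertex-removal G H@(digraph zero e) coreG coreH ((G≤H , G≄H) , _) =
  contradiction (twinFree∧order≥⇒≃F G H (fCore⇒twinFree G coreG) G≤H z≤n) G≄H
fGap⇒vertex-removal G H@(digraph (suc n) e) coreG coreH gap@((G≤H@(f , hom) , G≄H) , _) =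
  -- Any `v` outside the image of `f` works: `G` embeds in the rest, whose order is at most that of
  -- `G`.
  v , ≤E∧order≥⇒≅ G (removeVertex H v)
        (twinFree⇒≤E G (removeVertex H v) tf
          (avoiding⇒≤F-removeVertex e G v hom (proj₂ missed)))
        (ℕ.s≤s⁻¹ (fGap⇒order≤ G H coreH gap))
  where
  tf = fCore⇒twinFree G coreG
  missed = missed-value (ℕ.≰⇒> (G≄H ∘ twinFree∧order≥⇒≃F G H tf G≤H)) f
  v = proj₁ missed

-- Proper embeddings strictly increase the order, so an intermediate `K` would put the orders of `G`
-- and `H` at least two apart.
fGap⇒eGap : ∀ G H → IsFCore G → IsFCore H → IsFGap G H → IsEGap G H
fGap⇒eGap G H coreG coreH gap@((G≤H , G≄H) , _) =
  (twinFree⇒≤E G H (fCore⇒twinFree G coreG) G≤H , G≄H ∘ ≅⇒≃F G H) ,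
  λ (K , (G≤K , G≇K) , (K≤H , K≇H)) →
    ℕ.<⇒≱ (ℕ.≤-<-trans (ℕ.≰⇒> (G≇K ∘ ≤E∧order≥⇒≅ G K G≤K))
                       (ℕ.≰⇒> (K≇H ∘ ≤E∧order≥⇒≅ K H K≤H)))
          (fGap⇒order≤ G H coreH gap)

eGap⇒fGap : ∀ G H → IsFCore G → IsFCore H → IsEGap G H → IsFGap G H
eGap⇒fGap G H coreG coreH ((G≤H , G≇H) , between) =
  (≤E⇒≤F {G} {H} G≤H , λ G≃H →
    -- Minimality of `H` in its class bounds its order by that of `G`, so the embedding would be an
    -- isomorphism.
    G≇H (≤E∧order≥⇒≅ G H G≤H (coreH G (≃F-sym {G} {H} G≃H)))) ,
  λ (K , (G≤K , G≄K) , (K≤H , K≄H)) →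
    -- `K` may have twins and then need not embed in `H`; its twin-free representative `C` does.
    let C , tf , K≃C@(K≤C , C≤K) = twinFree-representative (order K) (edge K) in
    between (C ,
      (twinFree⇒≤E G C (fCore⇒twinFree G coreG) (≤F-trans {G} {K} {C} G≤K K≤C) ,
        λ G≅C → G≄K (≃F-trans {G} {C} {K} (≅⇒≃F G C G≅C) (≃F-sym {K} {C} K≃C))) ,
      (twinFree⇒≤E C H tf (≤F-trans {C} {K} {H} C≤K K≤H) ,
        λ C≅H → K≄H (≃F-trans {K} {C} {H} K≃C (≅⇒≃F C H C≅H))))

theorem5p5p6 : (G H : Digraph) → IsFCore G → IsFCore H →
    (IsFGap G H → ∃[ v ] (G ≅ removeVertex H v)) × (IsFGap G H ⇔ IsEGap G H)
theorem5p5p6 G H coreG coreH =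
  fGap⇒vertex-removal G H coreG coreH ,
  mk⇔ (fGap⇒eGap G H coreG coreH) (eGap⇒fGap G H coreG coreH)
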